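{- Let $n, k, \ell$ be positive integers with $n \geq k\ell$, $\ell \geq 2$, and $k \geq 3$. If $\mathcal{P}$ is an intersecting family of $(k,\ell)$-subpartitions of $[n]$, then $$|\mathcal{P}| \leq \frac{1}{(\ell-1)!} \prod_{i=1}^{\ell-1}\binom{n-ik}{k}.$$ Moreover, this bound is attained only by a canonical intersecting family of $(k,\ell)$-subpartitions, i.e. a family consisting of all $(k,\ell)$-subpartitions of $[n]$ that contain a fixed $k$-subset of $[n]$ as one of their classes.
   Context: Let $[n]=\{1,\dots,n\}$. A $(k,\ell)$-subpartition of $[n]$ is a set $P=\{P_1,\dots,P_\ell\}$ of $\ell$ pairwise disjoint $k$-subsets of $[n]$ (called classes); thus $|\bigcup_i P_i| = k\ell$. Two $(k,\ell)$-subpartitions $P=\{P_1,\dots,P_\ell\}$ and $Q=\{Q_1,\dots,Q_\ell\}$ are intersecting if $P_i=Q_j$ for some $i,j$, i.e. they have a common class. A family is intersecting if every two of its members are intersecting. -}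

module Defs where

open import Data.Nat using (ℕ; zero; suc; _*_; _∸_; _!)
open import Data.Nat.Combinatorics using (_C_)
open import Data.Fin.Subset using (Subset; ∣_∣; _∩_; Empty)
open import Data.List using (List; length)
open import Data.List.Membership.Propositional using (_∈_)
open import Data.List.Relation.Unary.All using (All)
open import Data.List.Relation.Unary.AllPairs using (AllPairs)
open import Data.Product using (_×_; ∃)
open import Relation.Binary.PropositionalEquality using (_≡_)
open import Relation.Nullary using (¬_)

Disjoint : ∀ {n} → Subset n → Subset n → Set
Disjoint p q = Empty (p ∩ q)

-- A (k,ℓ)-subpartition of [n]: ℓ pairwise disjoint k-subsets of [n].
-- Represented by a list of its classes; two such lists represent the same
-- subpartition iff they have the same classes (see SameClasses).
record SubPartition (n k ℓ : ℕ) : Set where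
  field
    classes : List (Subset n)
    len     : length classes ≡ ℓ
    sizes   : All (λ c → ∣ c ∣ ≡ k) classes
    disj    : AllPairs Disjoint classes
open SubPartition public

SameClasses : ∀ {n k ℓ} → SubPartition n k ℓ → SubPartition n k ℓ → Set
SameClasses P Q = (∀ c → c ∈ classes P → c ∈ classes Q)
                × (∀ c → c ∈ classes Q → c ∈ classes P)

Intersecting : ∀ {n k ℓ} → SubPartition n k ℓ → SubPartition n k ℓ → Set
Intersecting P Q = ∃ λ c → c ∈ classes P × c ∈ classes Q

-- A family of subpartitions: a list with no two members equal (as subpartitions);
-- its cardinality is the length of the list.
Distinct : ∀ {n k ℓ} → List (SubPartition n k ℓ) → Set
Distinct F = AllPairs (λ P Q → ¬ SameClasses P Q) F

IntersectingFamily : ∀ {n k ℓ} → List (SubPartition n k ℓ) → Set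
IntersectingFamily F = ∀ P Q → P ∈ F → Q ∈ F → Intersecting P Q

prodBinom : ℕ → ℕ → ℕ → ℕ
prodBinom n k zero    = 1
prodBinom n k (suc m) = prodBinom n k m * ((n ∸ suc m * k) C k)

{-# OPTIONS --safe #-}

-- Call a family trivial if its members share a class.  Double counting pairs
-- (P , A) with A a further class of P bounds the number of subpartitions that
-- contain j prescribed classes by  ∏_{j ≤ i < ℓ} C(n - ik, k) / (ℓ - j)!.  For
-- j = 1 this is the bound for trivial families; a trivial family attaining it
-- cannot be enlarged, hence is canonical.
--
-- In a nontrivial family fix P₀.  Every member contains one of the ℓ classes A
-- of P₀, and, if Q is a member without A, every member containing A also
-- contains one of the ℓ classes of Q.  So the family has at most ℓ² times as
-- many members as there are subpartitions through two given classes, which is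
-- strictly below the bound because ℓ²(ℓ - 1) < C(n - k, k).  The last inequality
-- may fail for ℓ = 2 and small n, but there a nontrivial family contains three
-- subpartitions on three pairwise disjoint classes, so n ≥ 3k.

module Submission where

open import Defs
open import Data.Bool using (true; false)
import Data.Bool.Properties as Bool
open import Data.Fin.Subset using (Subset; ∣_∣; _∪_; ⋃; ⊥; inside; outside)
open import Data.Fin.Subset.Properties using (x∈p∩q⁺; x∈p∩q⁻; x∈p∪q⁺; x∈p∪q⁻; ∉⊥; ∣⊥∣≡0; ∣p∣≤n; nonempty?; Empty-unique; drop-∷-Empty)
open import Data.List using (List; []; _∷_; [_]; _++_; length; filter; map)
open import Data.List.Membership.Propositional using (_∈_; _∉_; find; lose)
open import Data.List.Membership.Propositional.Properties using (∈-++⁺ˡ; ∈-++⁺ʳ; ∈-++⁻; ∈-∃++; ∈-map⁺; ∈-map⁻; ∈-filter⁺; ∈-filter⁻; ∈-length)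
open import Data.List.Properties using (length-map; length-++; length-++-sucʳ)
open import Data.List.Relation.Binary.Subset.Propositional using (_⊆_)
open import Data.List.Relation.Unary.All as All using (All; []; _∷_)
import Data.List.Relation.Unary.All.Properties as All
open import Data.List.Relation.Unary.AllPairs as AllPairs using (AllPairs; []; _∷_)
import Data.List.Relation.Unary.AllPairs.Properties as AllPairs
open import Data.List.Relation.Unary.Any as Any using (Any; here; there)
open import Data.List.Relation.Unary.Unique.Propositional using (Unique)
open import Data.Nat using (ℕ; zero; suc; _+_; _*_; _∸_; _!; _≤_; _<_; z≤n; s≤s; >-nonZero)
open import Data.Nat.Combinatorics using (_C_; nCn≡1; nC1≡n; nCk≡nC[n∸k]; nCk+nC[k+1]≡[n+1]C[k+1])
open import Data.Nat.ListAction using (sum)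
open import Data.Nat.Properties
open import Data.Nat.Tactic.RingSolver using (solve-∀)
open import Data.Product using (_×_; _,_; proj₁; proj₂; ∃)
open import Data.Sum using (inj₁; inj₂)
import Data.Vec as Vec
import Data.Vec.Properties as Vec
open import Function using (_∘_)
open import Function.Bundles using (_⇔_; mk⇔)
open import Relation.Binary.Definitions using (DecidableEquality)
open import Relation.Binary.PropositionalEquality using (_≡_; _≢_; refl; sym; trans; cong; cong₂; subst)
open import Relation.Nullary using (¬_; Dec; yes; no; does; contradiction)
open import Relation.Nullary.Decidable using (map′; _×-dec_)

-- Binomial coefficients

nC0≡1 : ∀ n → n C 0 ≡ 1
nC0≡1 n = trans (nCk≡nC[n∸k] {n = n} z≤n) (nCn≡1 n)

C-stepˡ : ∀ n k → n C k ≤ suc n C k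
C-stepˡ n zero    = ≤-reflexive (trans (nC0≡1 n) (sym (nC0≡1 (suc n))))
C-stepˡ n (suc k) = ≤-trans (m≤n+m _ _) (≤-reflexive (nCk+nC[k+1]≡[n+1]C[k+1] n k))

C-step : ∀ n k → n C k ≤ suc n C suc k
C-step n k = ≤-trans (m≤m+n _ _) (≤-reflexive (nCk+nC[k+1]≡[n+1]C[k+1] n k))

C-monoˡ-≤ : ∀ k {m n} → m ≤ n → m C k ≤ n C k
C-monoˡ-≤ k {m} {n} m≤n = subst (λ x → m C k ≤ x C k) (m∸n+n≡m m≤n) (go (n ∸ m))
  where
  go : ∀ d → m C k ≤ (d + m) C k
  go zero    = ≤-refl
  go (suc d) = ≤-trans (go d) (C-stepˡ (d + m) k)

C-positive : ∀ {n k} → k ≤ n → 1 ≤ n C k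
C-positive {k = k} k≤n = ≤-trans (≤-reflexive (sym (nCn≡1 k))) (C-monoˡ-≤ k k≤n)

-- The ratio of the indices stays `suc m`: each induction step raises both indices once by `C-step`
-- and the upper one `m` further times by `C-monoˡ-≤`.
C-multiple-mono : ∀ m i j → ((j * suc m) C j) ≤ ((i + j) * suc m) C (i + j)
C-multiple-mono m zero    j = ≤-refl
C-multiple-mono m (suc i) j = ≤-trans (C-multiple-mono m i j)
  (≤-trans (C-step ((i + j) * suc m) (i + j)) (C-monoˡ-≤ (suc i + j) (s≤s (m≤n+m _ m))))

2*C2 : ∀ n → 2 * (suc n C 2) ≡ n * suc n
2*C2 zero    = refl
2*C2 (suc n) = begin-equality
  2 * (suc (suc n) C 2)          ≡⟨ cong (2 *_) (nCk+nC[k+1]≡[n+1]C[k+1] (suc n) 1) ⟨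
  2 * (suc n C 1 + suc n C 2)    ≡⟨ *-distribˡ-+ 2 (suc n C 1) _ ⟩
  2 * (suc n C 1) + 2 * (suc n C 2) ≡⟨ cong₂ _+_ (cong (2 *_) (nC1≡n (suc n))) (2*C2 n) ⟩
  2 * suc n + n * suc n          ≡⟨ lemma n ⟩
  suc n * suc (suc n)            ∎
  where
  open ≤-Reasoning
  lemma : ∀ n → 2 * suc n + n * suc n ≡ suc n * suc (suc n)
  lemma = solve-∀

-- Multiplying by 6 and shifting to `2 + n` avoids division and truncated subtraction; Pascal's rule
-- reduces the step to `2*C2`.
6*C3 : ∀ n → 6 * ((2 + n) C 3) ≡ n * (1 + n) * (2 + n)
6*C3 zero    = refl
6*C3 (suc n) = begin-equality
  6 * ((3 + n) C 3)                       ≡⟨ cong (6 *_) (nCk+nC[k+1]≡[n+1]C[k+1] (2 + n) 2) ⟨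
  6 * ((2 + n) C 2 + (2 + n) C 3)         ≡⟨ *-distribˡ-+ 6 ((2 + n) C 2) _ ⟩
  6 * ((2 + n) C 2) + 6 * ((2 + n) C 3)   ≡⟨ cong₂ _+_ (*-assoc 3 2 ((2 + n) C 2)) (6*C3 n) ⟩
  3 * (2 * ((2 + n) C 2)) + n * (1 + n) * (2 + n) ≡⟨ cong (λ x → 3 * x + n * (1 + n) * (2 + n)) (2*C2 (suc n)) ⟩
  3 * ((1 + n) * (2 + n)) + n * (1 + n) * (2 + n) ≡⟨ lemma n ⟩
  (1 + n) * (2 + n) * (3 + n)             ∎
  where
  open ≤-Reasoning
  lemma : ∀ n → 3 * ((1 + n) * (2 + n)) + n * (1 + n) * (2 + n) ≡ (1 + n) * (2 + n) * (3 + n)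
  lemma = solve-∀

cubic<C3 : ∀ q → (2 + q) * ((3 + q) * (3 + q)) < (3 * (2 + q)) C 3
cubic<C3 q = *-cancelˡ-< 6 _ _ (begin-strict
  6 * ((2 + q) * ((3 + q) * (3 + q)))
    <⟨ m<m+n _ (s≤s z≤n) ⟩
  -- The added term is the difference of the two cubics; its coefficients are all positive.
  6 * ((2 + q) * ((3 + q) * (3 + q))) + 3 * (2 + q) * (2 + 15 * q + 7 * (q * q))
    ≡⟨ expand q ⟩
  (4 + 3 * q) * (1 + (4 + 3 * q)) * (2 + (4 + 3 * q))
    ≡⟨ 6*C3 (4 + 3 * q) ⟨
  6 * ((2 + (4 + 3 * q)) C 3)
    ≡⟨ cong (λ x → 6 * (x C 3)) (triple q) ⟩
  6 * ((3 * (2 + q)) C 3) ∎)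
  where
  open ≤-Reasoning
  expand : ∀ q → 6 * ((2 + q) * ((3 + q) * (3 + q))) + 3 * (2 + q) * (2 + 15 * q + 7 * (q * q))
         ≡ (4 + 3 * q) * (1 + (4 + 3 * q)) * (2 + (4 + 3 * q))
  expand = solve-∀
  triple : ∀ q → 2 + (4 + 3 * q) ≡ 3 * (2 + q)
  triple = solve-∀

-- `C-multiple-mono` with ratio `2 + q` reduces every `k ≥ 3` to `k = 3`, which is `cubic<C3`. With
-- ℓ = 3 + q and N = n - k this is ℓ²(ℓ - 1) < C(n - k, k).
cubic<C : ∀ {k} q {N} → 3 ≤ k → k * (2 + q) ≤ N → (2 + q) * ((3 + q) * (3 + q)) < N C k
cubic<C {k} q {N} 3≤k h = <-≤-trans (cubic<C3 q) (≤-trans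
  (subst (λ x → (3 * (2 + q)) C 3 ≤ (x * (2 + q)) C x) (m∸n+n≡m 3≤k) (C-multiple-mono (suc q) (k ∸ 3) 3))
  (C-monoˡ-≤ k h))

-- Finite lists

-- Pigeonhole: cutting the head `x` out of `ys` leaves the tail of `xs` covered, because `x` does
-- not recur there.
unique-⊆⇒length≤ : ∀ {A : Set} {xs ys : List A} → Unique xs → xs ⊆ ys → length xs ≤ length ys
unique-⊆⇒length≤ {xs = []} _ _ = z≤n
unique-⊆⇒length≤ {xs = x ∷ xs} (x∉xs ∷ uxs) sub with ∈-∃++ (sub (here refl))
... | us , vs , refl = ≤-trans (s≤s (unique-⊆⇒length≤ uxs sub′)) (≤-reflexive (sym (length-++-sucʳ us x vs)))
  where
  sub′ : xs ⊆ us ++ vs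
  sub′ y∈xs with ∈-++⁻ us (sub (there y∈xs))
  ... | inj₁ y∈us          = ∈-++⁺ˡ y∈us
  ... | inj₂ (here refl)   = contradiction refl (All.lookup x∉xs y∈xs)
  ... | inj₂ (there y∈vs)  = ∈-++⁺ʳ us y∈vs

-- Double counting of incidences

module _ {A B : Set} {R : A → B → Set} (R? : ∀ x y → Dec (R x y)) where

  incidences : List A → List B → ℕ
  incidences xs ys = sum (map (λ x → length (filter (R? x) ys)) xs)

  incidences-[]ʳ : ∀ xs → incidences xs [] ≡ 0
  incidences-[]ʳ []       = refl
  incidences-[]ʳ (x ∷ xs) = incidences-[]ʳ xs

  -- This exchanges the order of summation: `incidences` sums over `xs`, and the recursion exposes
  -- it as a sum over `ys`.
  incidences-∷ʳ : ∀ xs y ys →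
    incidences xs (y ∷ ys) ≡ length (filter (λ x → R? x y) xs) + incidences xs ys
  incidences-∷ʳ []       y ys = refl
  -- The filters on both sides of the goal branch on the same `does (R? x y)`, so one abstraction
  -- reduces both.
  incidences-∷ʳ (x ∷ xs) y ys with does (R? x y) | incidences-∷ʳ xs y ys
  ... | false | ih = trans (cong (a +_) ih) (swap a (length (filter (λ x → R? x y) xs)) (incidences xs ys))
    where
    a = length (filter (R? x) ys)
    swap : ∀ a b c → a + (b + c) ≡ b + (a + c)
    swap = solve-∀
  ... | true  | ih = trans (cong (suc a +_) ih) (swap a (length (filter (λ x → R? x y) xs)) (incidences xs ys))
    where
    a = length (filter (R? x) ys)
    swap : ∀ a b c → suc a + (b + c) ≡ suc b + (a + c)
    swap = solve-∀

  incidences-≥ : ∀ m xs ys → (∀ {x} → x ∈ xs → m ≤ length (filter (R? x) ys)) →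
    m * length xs ≤ incidences xs ys
  incidences-≥ m []       ys _ = ≤-reflexive (*-zeroʳ m)
  incidences-≥ m (x ∷ xs) ys h = ≤-trans (≤-reflexive (*-suc m (length xs)))
    (+-mono-≤ (h (here refl)) (incidences-≥ m xs ys (h ∘ there)))

  incidences-≤ : ∀ c b xs ys → (∀ {y} → y ∈ ys → c * length (filter (λ x → R? x y) xs) ≤ b) →
    c * incidences xs ys ≤ length ys * b
  incidences-≤ c b xs []       _ = ≤-reflexive (trans (cong (c *_) (incidences-[]ʳ xs)) (*-zeroʳ c))
  incidences-≤ c b xs (y ∷ ys) h = begin
    c * incidences xs (y ∷ ys)                                      ≡⟨ cong (c *_) (incidences-∷ʳ xs y ys) ⟩
    c * (length (filter (λ x → R? x y) xs) + incidences xs ys)      ≡⟨ *-distribˡ-+ c _ (incidences xs ys) ⟩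
    c * length (filter (λ x → R? x y) xs) + c * incidences xs ys    ≤⟨ +-mono-≤ (h (here refl)) (incidences-≤ c b xs ys (h ∘ there)) ⟩
    b + length ys * b                                               ∎
    where open ≤-Reasoning

  -- The factor `c` replaces a division: in the applications it is a factorial, and the bound for
  -- each `y` is known only after multiplication by it.
  double-count : ∀ m c b xs ys →
    (∀ {x} → x ∈ xs → m ≤ length (filter (R? x) ys)) →
    (∀ {y} → y ∈ ys → c * length (filter (λ x → R? x y) xs) ≤ b) →
    c * (m * length xs) ≤ length ys * b
  double-count m c b xs ys h₁ h₂ =
    ≤-trans (*-monoʳ-≤ c (incidences-≥ m xs ys h₁)) (incidences-≤ c b xs ys h₂)

-- Subsets of [n]

_≟ₛ_ : ∀ {n} → DecidableEquality (Subset n)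
_≟ₛ_ = Vec.≡-dec Bool._≟_

_∈?_ : ∀ {n} (p : Subset n) (ps : List (Subset n)) → Dec (p ∈ ps)
p ∈? ps = Any.any? (p ≟ₛ_) ps

disjoint-sym : ∀ {n} {p q : Subset n} → Disjoint p q → Disjoint q p
disjoint-sym {p = p} {q} d (x , x∈) with x∈p∩q⁻ q p x∈
... | x∈q , x∈p = d (x , x∈p∩q⁺ (x∈p , x∈q))

-- Only the empty set is disjoint from itself, and `1 ≤ k` rules it out.
disjoint⇒≢ : ∀ {n k} {p q : Subset n} → 1 ≤ k → ∣ p ∣ ≡ k → Disjoint p q → p ≢ q
disjoint⇒≢ {n} {p = p} 1≤k ∣p∣≡k d refl with nonempty? p
... | yes (x , x∈p) = d (x , x∈p∩q⁺ (x∈p , x∈p))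
... | no  empty     = contradiction
  (trans (sym ∣p∣≡k) (trans (cong ∣_∣ (Empty-unique empty)) (∣⊥∣≡0 n))) (>⇒≢ 1≤k)

disjoint-⋃ : ∀ {n} {p : Subset n} {qs} → All (Disjoint p) qs → Disjoint p (⋃ qs)
disjoint-⋃ {p = p} {[]} [] (x , x∈) = ∉⊥ (proj₂ (x∈p∩q⁻ p ⊥ x∈))
disjoint-⋃ {p = p} {q ∷ qs} (d ∷ ds) (x , x∈) with x∈p∩q⁻ p (q ∪ ⋃ qs) x∈
... | x∈p , x∈∪ with x∈p∪q⁻ q (⋃ qs) x∈∪
...   | inj₁ x∈q = d (x , x∈p∩q⁺ (x∈p , x∈q))
...   | inj₂ x∈⋃ = disjoint-⋃ ds (x , x∈p∩q⁺ (x∈p , x∈⋃))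

disjoint-⋃⁻ : ∀ {n} {p : Subset n} {qs} → Disjoint p (⋃ qs) → All (Disjoint p) qs
disjoint-⋃⁻ {qs = []} _ = []
disjoint-⋃⁻ {p = p} {q ∷ qs} d =
    (λ (x , x∈) → let x∈p , x∈q = x∈p∩q⁻ p q x∈ in d (x , x∈p∩q⁺ (x∈p , x∈p∪q⁺ (inj₁ x∈q))))
  ∷ disjoint-⋃⁻ (λ (x , x∈) → let x∈p , x∈⋃ = x∈p∩q⁻ p (⋃ qs) x∈ in d (x , x∈p∩q⁺ (x∈p , x∈p∪q⁺ (inj₂ x∈⋃))))

disjoint-∣∪∣ : ∀ {n} (p q : Subset n) → Disjoint p q → ∣ p ∪ q ∣ ≡ ∣ p ∣ + ∣ q ∣
disjoint-∣∪∣ Vec.[] Vec.[] _ = refl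
disjoint-∣∪∣ (true  Vec.∷ p) (true  Vec.∷ q) d = contradiction (_ , Vec.here) d
disjoint-∣∪∣ (true  Vec.∷ p) (false Vec.∷ q) d = cong suc (disjoint-∣∪∣ p q (drop-∷-Empty d))
disjoint-∣∪∣ (false Vec.∷ p) (true  Vec.∷ q) d =
  trans (cong suc (disjoint-∣∪∣ p q (drop-∷-Empty d))) (sym (+-suc ∣ p ∣ ∣ q ∣))
disjoint-∣∪∣ (false Vec.∷ p) (false Vec.∷ q) d = disjoint-∣∪∣ p q (drop-∷-Empty d)

disjoint-∣⋃∣ : ∀ {n k} {ps : List (Subset n)} → AllPairs Disjoint ps → All (λ p → ∣ p ∣ ≡ k) ps →
  ∣ ⋃ ps ∣ ≡ length ps * k
disjoint-∣⋃∣ {n} [] [] = ∣⊥∣≡0 n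
disjoint-∣⋃∣ {ps = p ∷ ps} (d ∷ ds) (s ∷ ss) =
  trans (disjoint-∣∪∣ p (⋃ ps) (disjoint-⋃ d)) (cong₂ _+_ s (disjoint-∣⋃∣ ds ss))

disjoint⇒unique : ∀ {n k} {ps : List (Subset n)} → 1 ≤ k → AllPairs Disjoint ps →
  All (λ p → ∣ p ∣ ≡ k) ps → Unique ps
disjoint⇒unique 1≤k [] [] = []
disjoint⇒unique 1≤k (d ∷ ds) (s ∷ ss) =
  All.map (disjoint⇒≢ 1≤k s) d ∷ disjoint⇒unique 1≤k ds ss

distinct⇒disjoint : ∀ {n} {ps : List (Subset n)} {p q} → AllPairs Disjoint ps →
  p ∈ ps → q ∈ ps → p ≢ q → Disjoint p q
distinct⇒disjoint (d ∷ ds) (here refl) (here refl) p≢q = contradiction refl p≢q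
distinct⇒disjoint (d ∷ ds) (here refl) (there q∈)  _   = All.lookup d q∈
distinct⇒disjoint (d ∷ ds) (there p∈)  (here refl) _   = disjoint-sym (All.lookup d p∈)
distinct⇒disjoint (d ∷ ds) (there p∈)  (there q∈)  p≢q = distinct⇒disjoint ds p∈ q∈ p≢q

-- These are the candidates for a further class once the points of `u` are used up. Branching at
-- each coordinate outside `u` mirrors Pascal's rule, which makes the length a binomial coefficient.
subsetsAvoiding : ∀ {n} → Subset n → ℕ → List (Subset n)
subsetsAvoiding Vec.[]            zero    = [ Vec.[] ]
subsetsAvoiding Vec.[]            (suc k) = []
subsetsAvoiding (true  Vec.∷ u) k         = map (outside Vec.∷_) (subsetsAvoiding u k)
subsetsAvoiding (false Vec.∷ u) zero      = map (outside Vec.∷_) (subsetsAvoiding u zero)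
subsetsAvoiding (false Vec.∷ u) (suc k)   =
  map (inside Vec.∷_) (subsetsAvoiding u k) ++ map (outside Vec.∷_) (subsetsAvoiding u (suc k))

length-subsetsAvoiding : ∀ {n} (u : Subset n) k → length (subsetsAvoiding u k) ≡ (n ∸ ∣ u ∣) C k
length-subsetsAvoiding Vec.[] zero    = refl
length-subsetsAvoiding Vec.[] (suc k) = refl
length-subsetsAvoiding (true Vec.∷ u) k = trans (length-map _ (subsetsAvoiding u k)) (length-subsetsAvoiding u k)
length-subsetsAvoiding {suc n} (false Vec.∷ u) zero = trans (length-map _ (subsetsAvoiding u zero))
  (trans (length-subsetsAvoiding u zero) (trans (nC0≡1 (n ∸ ∣ u ∣)) (sym (nC0≡1 (suc n ∸ ∣ u ∣)))))
length-subsetsAvoiding {suc n} (false Vec.∷ u) (suc k) = begin-equality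
  length (map (inside Vec.∷_) (subsetsAvoiding u k) ++ map (outside Vec.∷_) (subsetsAvoiding u (suc k)))
    ≡⟨ length-++ (map (inside Vec.∷_) (subsetsAvoiding u k)) ⟩
  length (map (inside Vec.∷_) (subsetsAvoiding u k)) + length (map (outside Vec.∷_) (subsetsAvoiding u (suc k)))
    ≡⟨ cong₂ _+_ (length-map _ (subsetsAvoiding u k)) (length-map _ (subsetsAvoiding u (suc k))) ⟩
  length (subsetsAvoiding u k) + length (subsetsAvoiding u (suc k))
    ≡⟨ cong₂ _+_ (length-subsetsAvoiding u k) (length-subsetsAvoiding u (suc k)) ⟩
  (n ∸ ∣ u ∣) C k + (n ∸ ∣ u ∣) C suc k
    ≡⟨ nCk+nC[k+1]≡[n+1]C[k+1] (n ∸ ∣ u ∣) k ⟩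
  suc (n ∸ ∣ u ∣) C suc k
    ≡⟨ cong (_C suc k) (+-∸-assoc 1 (∣p∣≤n u)) ⟨
  (suc n ∸ ∣ u ∣) C suc k ∎
  where open ≤-Reasoning

∈-subsetsAvoiding⁺ : ∀ {n} (u : Subset n) {k p} → ∣ p ∣ ≡ k → Disjoint p u → p ∈ subsetsAvoiding u k
∈-subsetsAvoiding⁺ Vec.[] {p = Vec.[]} refl _ = here refl
∈-subsetsAvoiding⁺ (true Vec.∷ u) {p = true Vec.∷ p} _ d = contradiction (_ , Vec.here) d
∈-subsetsAvoiding⁺ (true Vec.∷ u) {p = false Vec.∷ p} e d =
  ∈-map⁺ _ (∈-subsetsAvoiding⁺ u e (drop-∷-Empty d))
∈-subsetsAvoiding⁺ (false Vec.∷ u) {p = true Vec.∷ p} refl d =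
  ∈-++⁺ˡ (∈-map⁺ _ (∈-subsetsAvoiding⁺ u refl (drop-∷-Empty d)))
∈-subsetsAvoiding⁺ (false Vec.∷ u) {zero} {false Vec.∷ p} e d =
  ∈-map⁺ _ (∈-subsetsAvoiding⁺ u e (drop-∷-Empty d))
∈-subsetsAvoiding⁺ (false Vec.∷ u) {suc k} {false Vec.∷ p} e d =
  ∈-++⁺ʳ (map (inside Vec.∷_) (subsetsAvoiding u k)) (∈-map⁺ _ (∈-subsetsAvoiding⁺ u e (drop-∷-Empty d)))

disjoint-outside : ∀ {n} s {p q : Subset n} → Disjoint p q → Disjoint (outside Vec.∷ p) (s Vec.∷ q)
disjoint-outside s d (_ , Vec.there x∈) = d (_ , x∈)

∈-subsetsAvoiding⁻ : ∀ {n} (u : Subset n) k {p} → p ∈ subsetsAvoiding u k → ∣ p ∣ ≡ k × Disjoint p u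
∈-subsetsAvoiding⁻ Vec.[] zero (here refl) = refl , λ ()
∈-subsetsAvoiding⁻ (true Vec.∷ u) k p∈ with ∈-map⁻ _ p∈
... | q , q∈ , refl = let e , d = ∈-subsetsAvoiding⁻ u k q∈ in e , disjoint-outside true d
∈-subsetsAvoiding⁻ (false Vec.∷ u) zero p∈ with ∈-map⁻ _ p∈
... | q , q∈ , refl = let e , d = ∈-subsetsAvoiding⁻ u zero q∈ in e , disjoint-outside false d
∈-subsetsAvoiding⁻ (false Vec.∷ u) (suc k) p∈ with ∈-++⁻ (map (inside Vec.∷_) (subsetsAvoiding u k)) p∈
... | inj₁ p∈₁ with ∈-map⁻ _ p∈₁
...   | q , q∈ , refl = let e , d = ∈-subsetsAvoiding⁻ u k q∈ in
        cong suc e , λ { (_ , Vec.there x∈) → d (_ , x∈) }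
∈-subsetsAvoiding⁻ (false Vec.∷ u) (suc k) p∈ | inj₂ p∈₂ with ∈-map⁻ _ p∈₂
...   | q , q∈ , refl = let e , d = ∈-subsetsAvoiding⁻ u (suc k) q∈ in e , disjoint-outside false d

-- Counting subpartitions through given classes

-- The product of C(n - ik, k) over j ≤ i < j + m. Unlike `prodBinom` it peels off the first factor,
-- to match `count-through`, where each newly prescribed class raises `j`.
binomProduct : ℕ → ℕ → ℕ → ℕ → ℕ
binomProduct n k j zero    = 1
binomProduct n k j (suc m) = ((n ∸ j * k) C k) * binomProduct n k (suc j) m

binomProduct-last : ∀ n k j m →
  binomProduct n k j (suc m) ≡ binomProduct n k j m * ((n ∸ (j + m) * k) C k)
binomProduct-last n k j zero rewrite +-identityʳ j = *-comm ((n ∸ j * k) C k) 1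
binomProduct-last n k j (suc m) rewrite +-suc j m =
  trans (cong (((n ∸ j * k) C k) *_) (binomProduct-last n k (suc j) m))
        (sym (*-assoc ((n ∸ j * k) C k) (binomProduct n k (suc j) m) _))

prodBinom≡binomProduct : ∀ n k m → prodBinom n k m ≡ binomProduct n k 1 m
prodBinom≡binomProduct n k zero    = refl
prodBinom≡binomProduct n k (suc m) =
  trans (cong (_* ((n ∸ suc m * k) C k)) (prodBinom≡binomProduct n k m)) (sym (binomProduct-last n k 1 m))

-- For i < j + m the hypothesis gives (i + 1)k ≤ n, hence n - ik ≥ k, and no factor vanishes.
binomProduct-positive : ∀ {n k} j m → k * (j + m) ≤ n → 1 ≤ binomProduct n k j m
binomProduct-positive j zero _ = ≤-refl
binomProduct-positive {n} {k} j (suc m) h = *-mono-≤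
  (C-positive (m+n≤o⇒m≤o∸n k (≤-trans (≤-reflexive (*-comm (suc j) k)) (≤-trans (*-monoʳ-≤ k sj≤) h))))
  (binomProduct-positive (suc j) m (subst (λ x → k * x ≤ n) (+-suc j m) h))
  where
  sj≤ : suc j ≤ j + suc m
  sj≤ = ≤-trans (m≤m+n (suc j) m) (≤-reflexive (sym (+-suc j m)))

_∋?_ : ∀ {n k ℓ} (P : SubPartition n k ℓ) A → Dec (A ∈ classes P)
P ∋? A = A ∈? classes P

through : ∀ {n k ℓ} → Subset n → List (SubPartition n k ℓ) → List (SubPartition n k ℓ)
through A = filter (_∋? A)

classes-disjoint : ∀ {n k ℓ} (P : SubPartition n k ℓ) {A B} →
  A ∈ classes P → B ∈ classes P → A ≢ B → Disjoint A B
classes-disjoint P = distinct⇒disjoint (disj P)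

size : ∀ {n k ℓ} (P : SubPartition n k ℓ) {A} → A ∈ classes P → ∣ A ∣ ≡ k
size P = All.lookup (sizes P)

-- Induction on the number `m` of classes left free. Pairs of a member and a further class of it are
-- counted twice: each member has at least `m` such classes, and fixing one leaves the same problem
-- with `m` lowered by one. The factors `m` accumulate to the factorial.
count-through : ∀ {n k ℓ} → 1 ≤ k → ∀ m (Cs : List (Subset n)) → length Cs + m ≡ ℓ →
  AllPairs Disjoint Cs → All (λ A → ∣ A ∣ ≡ k) Cs →
  (F : List (SubPartition n k ℓ)) → Distinct F →
  (∀ {P} → P ∈ F → Cs ⊆ classes P) →
  m ! * length F ≤ binomProduct n k (length Cs) m
count-through {ℓ = ℓ} 1≤k zero Cs len≡ dCs sCs F dF Cs⊆ = ≤-trans (≤-reflexive (*-identityˡ (length F))) (atMostOne F dF Cs⊆)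
  where
  -- A class of `P` outside `Cs` would yield ℓ + 1 distinct classes of `P`. So with no class left
  -- free, `Cs` determines the subpartition.
  ⊆Cs : ∀ P → Cs ⊆ classes P → classes P ⊆ Cs
  ⊆Cs P Cs⊆P {A} A∈P with A ∈? Cs
  ... | yes A∈Cs = A∈Cs
  ... | no  A∉Cs = contradiction
    (unique-⊆⇒length≤ (All.¬Any⇒All¬ Cs A∉Cs ∷ disjoint⇒unique 1≤k dCs sCs)
      λ { (here refl) → A∈P ; (there B∈) → Cs⊆P B∈ })
    (<⇒≱ (s≤s (≤-reflexive (trans (len P) (trans (sym len≡) (+-identityʳ _))))))

  atMostOne : ∀ F → Distinct F → (∀ {P} → P ∈ F → Cs ⊆ classes P) → length F ≤ 1
  atMostOne []      _ _ = z≤n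
  atMostOne (_ ∷ []) _ _ = ≤-refl
  atMostOne (P ∷ Q ∷ _) ((P≠Q ∷ _) ∷ _) Cs⊆ = contradiction
    ( (λ _ A∈P → Cs⊆ (there (here refl)) (⊆Cs P (Cs⊆ (here refl)) A∈P))
    , (λ _ A∈Q → Cs⊆ (here refl) (⊆Cs Q (Cs⊆ (there (here refl))) A∈Q)))
    P≠Q
count-through {n} {k} {ℓ} 1≤k (suc m) Cs len≡ dCs sCs F dF Cs⊆ = begin
  suc m * m ! * length F      ≡⟨ cong (_* length F) (*-comm (suc m) (m !)) ⟩
  m ! * suc m * length F      ≡⟨ *-assoc (m !) (suc m) (length F) ⟩
  m ! * (suc m * length F)    ≤⟨ double-count _∋?_ (suc m) (m !) (binomProduct n k (suc (length Cs)) m) F L many few ⟩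
  length L * binomProduct n k (suc (length Cs)) m
    ≡⟨ cong (_* binomProduct n k (suc (length Cs)) m)
         (trans (length-subsetsAvoiding (⋃ Cs) k) (cong (λ x → (n ∸ x) C k) (disjoint-∣⋃∣ dCs sCs))) ⟩
  binomProduct n k (length Cs) (suc m) ∎
  where
  open ≤-Reasoning
  L = subsetsAvoiding (⋃ Cs) k

  -- The ℓ distinct classes of `P` all lie in `Cs` or in `L`; cancelling `length Cs` leaves `suc m`
  -- of them for `L`.
  many : ∀ {P} → P ∈ F → suc m ≤ length (filter (P ∋?_) L)
  many {P} P∈F = +-cancelˡ-≤ (length Cs) _ _ (begin
    length Cs + suc m                       ≡⟨ trans len≡ (sym (len P)) ⟩
    length (classes P)                      ≤⟨ unique-⊆⇒length≤ (disjoint⇒unique 1≤k (disj P) (sizes P)) covered ⟩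
    length (Cs ++ filter (P ∋?_) L)         ≡⟨ length-++ Cs ⟩
    length Cs + length (filter (P ∋?_) L)   ∎)
    where
    covered : classes P ⊆ Cs ++ filter (P ∋?_) L
    covered {A} A∈P with A ∈? Cs
    ... | yes A∈Cs = ∈-++⁺ˡ A∈Cs
    ... | no  A∉Cs = ∈-++⁺ʳ Cs (∈-filter⁺ (P ∋?_) (∈-subsetsAvoiding⁺ (⋃ Cs) (size P A∈P)
      (disjoint-⋃ (All.tabulate λ B∈Cs → classes-disjoint P A∈P (Cs⊆ P∈F B∈Cs) λ { refl → A∉Cs B∈Cs }))) A∈P)

  -- `A` avoids `⋃ Cs`, so `A ∷ Cs` is again pairwise disjoint and the induction hypothesis applies
  -- to the members through `A`.
  few : ∀ {A} → A ∈ L → m ! * length (through A F) ≤ binomProduct n k (suc (length Cs)) m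
  few {A} A∈L with ∈-subsetsAvoiding⁻ (⋃ Cs) k A∈L
  ... | sA , dA = count-through 1≤k m (A ∷ Cs) (trans (sym (+-suc (length Cs) m)) len≡)
    (disjoint-⋃⁻ dA ∷ dCs) (sA ∷ sCs) (through A F) (AllPairs.filter⁺ (_∋? A) dF) sub
    where
    sub : ∀ {P} → P ∈ through A F → A ∷ Cs ⊆ classes P
    sub P∈ (here refl) = proj₂ (∈-filter⁻ (_∋? A) {xs = F} P∈)
    sub P∈ (there B∈)  = Cs⊆ (proj₁ (∈-filter⁻ (_∋? A) {xs = F} P∈)) B∈

-- Intersecting families

-- For `P₀` in `F` this says that `F` is nontrivial, since a class common to all members would be a
-- class of `P₀`. The positive form supplies the member `Q` directly.
NoCommonClass : ∀ {n k ℓ} → SubPartition n k ℓ → List (SubPartition n k ℓ) → Set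
NoCommonClass P₀ F = ∀ {A} → A ∈ classes P₀ → ∃ λ Q → Q ∈ F × A ∉ classes Q

intersecting⇒1≤ : ∀ {n k ℓ} {P Q : SubPartition n k ℓ} → Intersecting P Q →
  1 ≤ length (filter (P ∋?_) (classes Q))
intersecting⇒1≤ {P = P} (A , A∈P , A∈Q) = ∈-length (∈-filter⁺ (P ∋?_) A∈Q A∈P)

-- Two nested double counts, over the classes of `P₀` and then of `Q`, each use only that members
-- meet in at least one class and each cost a factor ℓ = 2 + p.
nontrivial-bound : ∀ {n k p} → 1 ≤ k → (F : List (SubPartition n k (2 + p))) → Distinct F →
  IntersectingFamily F → ∀ {P₀} → P₀ ∈ F → NoCommonClass P₀ F →
  p ! * length F ≤ (2 + p) * ((2 + p) * binomProduct n k 2 p)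
nontrivial-bound {n} {k} {p} 1≤k F dF iF {P₀} P₀∈F noCommon = begin
  p ! * length F          ≡⟨ cong (p ! *_) (*-identityˡ (length F)) ⟨
  p ! * (1 * length F)    ≤⟨ double-count _∋?_ 1 (p !) ((2 + p) * binomProduct n k 2 p) F (classes P₀)
                               (λ {P} P∈F → intersecting⇒1≤ {P = P} {P₀} (iF P P₀ P∈F P₀∈F)) one ⟩
  length (classes P₀) * ((2 + p) * binomProduct n k 2 p)
                          ≡⟨ cong (_* ((2 + p) * binomProduct n k 2 p)) (len P₀) ⟩
  (2 + p) * ((2 + p) * binomProduct n k 2 p) ∎
  where
  open ≤-Reasoning
  through⁻ : ∀ {A P} F → P ∈ through A F → P ∈ F × A ∈ classes P
  through⁻ F = ∈-filter⁻ (_∋? _) {xs = F}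

  one : ∀ {A} → A ∈ classes P₀ → p ! * length (through A F) ≤ (2 + p) * binomProduct n k 2 p
  one {A} A∈P₀ with noCommon A∈P₀
  ... | Q , Q∈F , A∉Q = begin
    p ! * length (through A F)         ≡⟨ cong (p ! *_) (*-identityˡ (length (through A F))) ⟨
    p ! * (1 * length (through A F))   ≤⟨ double-count _∋?_ 1 (p !) (binomProduct n k 2 p) (through A F) (classes Q)
                                            (λ {P} P∈ → intersecting⇒1≤ {P = P} {Q} (iF P Q (proj₁ (through⁻ F P∈)) Q∈F))
                                            (λ B∈Q → two B∈Q _ refl) ⟩
    length (classes Q) * binomProduct n k 2 p  ≡⟨ cong (_* binomProduct n k 2 p) (len Q) ⟩
    (2 + p) * binomProduct n k 2 p     ∎
    where
    -- `G` is a variable tied by an equation so that it can be split. If it is nonempty, its first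
    -- member shows that `A` and `B` are disjoint `k`-sets; they differ because `Q` contains `B` but
    -- not `A`.
    two : ∀ {B} → B ∈ classes Q → ∀ G → G ≡ through B (through A F) → p ! * length G ≤ binomProduct n k 2 p
    two B∈Q [] _ = subst (_≤ binomProduct n k 2 p) (sym (*-zeroʳ (p !))) z≤n
    two {B} B∈Q G@(P ∷ _) G≡ = count-through 1≤k p (A ∷ B ∷ []) refl
      ((classes-disjoint P A∈P B∈P (λ { refl → A∉Q B∈Q }) ∷ []) ∷ [] ∷ [])
      (size P A∈P ∷ size P B∈P ∷ []) G (subst Distinct (sym G≡) (AllPairs.filter⁺ (_∋? B) (AllPairs.filter⁺ (_∋? A) dF)))
      λ { R∈ (here refl) → proj₁ (both R∈) ; R∈ (there (here refl)) → proj₂ (both R∈) }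
      where
      both : ∀ {R} → R ∈ G → A ∈ classes R × B ∈ classes R
      both {R} R∈ = let R∈A , B∈R = through⁻ {P = R} (through A F) (subst (R ∈_) G≡ R∈) in
        proj₂ (through⁻ {P = R} F R∈A) , B∈R
      A∈P = proj₁ (both (here refl))
      B∈P = proj₂ (both (here refl))

two-elements : ∀ {A : Set} (xs : List A) → length xs ≡ 2 → ∃ λ x → ∃ λ y → xs ≡ x ∷ y ∷ []
two-elements (x ∷ y ∷ []) refl = x , y , refl

-- Let `P₀` have classes `A` and `B`. A member `Q` without `A` must share `B` with `P₀`, and a
-- member `R` without `B` must share `A`. The common class `D` of `Q` and `R` is then neither `A`
-- nor `B`, and each two of `A`, `B`, `D` occur together in a member.
nontrivial⇒3k≤n : ∀ {n k} {F : List (SubPartition n k 2)} → 1 ≤ k → IntersectingFamily F →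
  ∀ {P₀} → P₀ ∈ F → NoCommonClass P₀ F → 3 * k ≤ n
nontrivial⇒3k≤n {n} {k} 1≤k iF {P₀} P₀∈F noCommon with two-elements (classes P₀) (len P₀)
... | A , B , P₀≡ with noCommon A∈ | noCommon B∈
  where
  A∈ : A ∈ classes P₀
  A∈ = subst (A ∈_) (sym P₀≡) (here refl)
  B∈ : B ∈ classes P₀
  B∈ = subst (B ∈_) (sym P₀≡) (there (here refl))
... | Q , Q∈F , A∉Q | R , R∈F , B∉R with iF P₀ Q P₀∈F Q∈F | iF P₀ R P₀∈F R∈F | iF Q R Q∈F R∈F
... | X , X∈P₀ , X∈Q | Y , Y∈P₀ , Y∈R | D , D∈Q , D∈R
  with subst (X ∈_) P₀≡ X∈P₀ | subst (Y ∈_) P₀≡ Y∈P₀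
... | here refl         | _                 = contradiction X∈Q A∉Q
... | there (here refl) | there (here refl) = contradiction Y∈R B∉R
... | there (here refl) | here refl         =
  subst (_≤ n) (disjoint-∣⋃∣ pairwise (size R Y∈R ∷ size Q X∈Q ∷ size Q D∈Q ∷ [])) (∣p∣≤n (⋃ (A ∷ B ∷ D ∷ [])))
  where
  pairwise : AllPairs Disjoint (A ∷ B ∷ D ∷ [])
  pairwise = (classes-disjoint P₀ Y∈P₀ X∈P₀ (λ { refl → A∉Q X∈Q })
             ∷ classes-disjoint R Y∈R D∈R (λ { refl → A∉Q D∈Q }) ∷ [])
           ∷ (classes-disjoint Q X∈Q D∈Q (λ { refl → B∉R D∈R }) ∷ [])
           ∷ [] ∷ []

nontrivial-strict : ∀ {n k} p → 3 ≤ k → k * (2 + p) ≤ n → (F : List (SubPartition n k (2 + p))) →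
  Distinct F → IntersectingFamily F → ∀ {P₀} → P₀ ∈ F → NoCommonClass P₀ F →
  (1 + p) ! * length F < binomProduct n k 1 (1 + p)
nontrivial-strict {n} {k} p 3≤k kℓ≤n F dF iF P₀∈F noCommon = begin-strict
  (1 + p) * p ! * length F      ≡⟨ *-assoc (1 + p) (p !) (length F) ⟩
  (1 + p) * (p ! * length F)    ≤⟨ *-monoʳ-≤ (1 + p) (nontrivial-bound 1≤k F dF iF P₀∈F noCommon) ⟩
  (1 + p) * ((2 + p) * ((2 + p) * G))  ≡⟨ assoc (1 + p) (2 + p) G ⟩
  -- The cubic ℓ²(ℓ - 1) is compared with the first factor of the bound; strictness survives because
  -- the remaining product `G` is positive.
  (1 + p) * ((2 + p) * (2 + p)) * G    <⟨ *-monoˡ-< G {{>-nonZero G>0}} (cubic p F iF P₀∈F noCommon kℓ≤n) ⟩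
  ((n ∸ 1 * k) C k) * G          ∎
  where
  open ≤-Reasoning
  1≤k = ≤-trans (s≤s z≤n) 3≤k
  G = binomProduct n k 2 p
  G>0 : 1 ≤ G
  G>0 = binomProduct-positive 2 p kℓ≤n

  assoc : ∀ a b c → a * (b * (b * c)) ≡ a * (b * b) * c
  assoc = solve-∀

  cubic : ∀ p (F : List (SubPartition n k (2 + p))) → IntersectingFamily F →
    ∀ {P₀} → P₀ ∈ F → NoCommonClass P₀ F → k * (2 + p) ≤ n →
    (1 + p) * ((2 + p) * (2 + p)) < (n ∸ 1 * k) C k
  -- For ℓ = 2, `3 * k ≤ n` gives n - k ≥ 2k, so the inequality for ℓ = 3 applies; its left side 18
  -- exceeds the 4 needed here.
  cubic zero F iF P₀∈F noCommon _ = ≤-trans (s≤s (s≤s (s≤s (s≤s (s≤s z≤n))))) (cubic<C 0 3≤k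
    (m+n≤o⇒m≤o∸n (k * 2) (≤-trans (≤-reflexive (shape k)) (nontrivial⇒3k≤n 1≤k iF P₀∈F noCommon))))
    where
    shape : ∀ k → k * 2 + 1 * k ≡ 3 * k
    shape = solve-∀
  cubic (suc q) _ _ _ _ h = cubic<C q 3≤k (m+n≤o⇒m≤o∸n (k * (2 + q)) (≤-trans (≤-reflexive (shape k q)) h))
    where
    shape : ∀ k q → k * (2 + q) + 1 * k ≡ k * (3 + q)
    shape = solve-∀

-- Trivial families and the case of equality

sameClasses? : ∀ {n k ℓ} (P Q : SubPartition n k ℓ) → Dec (SameClasses P Q)
sameClasses? P Q = ⊆? P Q ×-dec ⊆? Q P
  where
  ⊆? : ∀ P Q → Dec (∀ c → c ∈ classes P → c ∈ classes Q)
  ⊆? P Q = map′ (λ h c → All.lookup h) (λ h → All.tabulate (h _)) (All.all? (_∈? classes Q) (classes P))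

trivial-bound : ∀ {n k p S} → 1 ≤ k → ∣ S ∣ ≡ k → (F : List (SubPartition n k (1 + p))) → Distinct F →
  All (λ P → S ∈ classes P) F → p ! * length F ≤ binomProduct n k 1 p
trivial-bound {p = p} {S} 1≤k sS F dF S∈ = count-through 1≤k p [ S ] refl ([] ∷ []) (sS ∷ []) F dF
  λ { P∈F (here refl) → All.lookup S∈ P∈F }

-- If Q ∋ S were missing from F, the family Q ∷ F would violate trivial-bound.
trivial-extremal : ∀ {n k p S} → 1 ≤ k → ∣ S ∣ ≡ k → (F : List (SubPartition n k (1 + p))) → Distinct F →
  All (λ P → S ∈ classes P) F → p ! * length F ≡ binomProduct n k 1 p →
  ∀ Q → S ∈ classes Q ⇔ Any (SameClasses Q) F
trivial-extremal {p = p} {S} 1≤k sS F dF S∈ attained Q = mk⇔ complete sound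
  where
  complete : S ∈ classes Q → Any (SameClasses Q) F
  complete S∈Q with Any.any? (sameClasses? Q) F
  ... | yes Q∈F = Q∈F
  ... | no  Q∉F = contradiction
    (trivial-bound 1≤k sS (Q ∷ F) (All.¬Any⇒All¬ F Q∉F ∷ dF) (S∈Q ∷ S∈))
    (<⇒≱ (subst (_< p ! * suc (length F)) attained (*-monoʳ-< (p !) {{p !≢0}} ≤-refl)))

  sound : Any (SameClasses Q) F → S ∈ classes Q
  sound Q∈F with find Q∈F
  ... | P , P∈F , _ , P⊆Q = P⊆Q S (All.lookup S∈ P∈F)

theorem1 : (n k ℓ : ℕ) → 1 ≤ n → 2 ≤ ℓ → 3 ≤ k → k * ℓ ≤ n →
    (F : List (SubPartition n k ℓ)) → Distinct F → IntersectingFamily F →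
    ((ℓ ∸ 1) ! * length F ≤ prodBinom n k (ℓ ∸ 1))
    × ((ℓ ∸ 1) ! * length F ≡ prodBinom n k (ℓ ∸ 1) →
       ∃ λ (S : Subset n) → ∣ S ∣ ≡ k ×
         ((Q : SubPartition n k ℓ) → (S ∈ classes Q ⇔ Any (SameClasses Q) F)))
theorem1 n k 1 _ (s≤s ())
theorem1 n k (suc (suc p)) _ _ 3≤k kℓ≤n F dF iF
  rewrite prodBinom≡binomProduct n k (suc p) = go F dF iF
  where
  1≤k = ≤-trans (s≤s z≤n) 3≤k

  go : (F : List (SubPartition n k (2 + p))) → Distinct F → IntersectingFamily F →
    (suc p ! * length F ≤ binomProduct n k 1 (suc p))
    × (suc p ! * length F ≡ binomProduct n k 1 (suc p) →
       ∃ λ (S : Subset n) → ∣ S ∣ ≡ k ×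
         ((Q : SubPartition n k (2 + p)) → (S ∈ classes Q ⇔ Any (SameClasses Q) F)))
  -- The bound is positive since kℓ ≤ n, so the empty family cannot attain it.
  go [] _ _ = <⇒≤ small , λ attained → contradiction attained (<⇒≢ small)
    where
    small : suc p ! * 0 < binomProduct n k 1 (suc p)
    small = subst (_< binomProduct n k 1 (suc p)) (sym (*-zeroʳ (suc p !))) (binomProduct-positive {k = k} 1 (suc p) kℓ≤n)
  -- Any class common to all of `F` is a class of `P₀`, so this finite search decides triviality.
  go F@(P₀ ∷ _) dF iF with Any.any? (λ A → All.all? (_∋? A) F) (classes P₀)
  ... | yes common = let S , S∈P₀ , S∈F = find common in
      trivial-bound 1≤k (size P₀ S∈P₀) F dF S∈F
    , λ attained → S , size P₀ S∈P₀ , trivial-extremal 1≤k (size P₀ S∈P₀) F dF S∈F attained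
  ... | no ¬common = <⇒≤ strict , λ attained → contradiction attained (<⇒≢ strict)
    where
    noCommon : NoCommonClass P₀ F
    -- Decidability of `_∋?_` turns the failed search into an explicit member without `A`.
    noCommon {A} A∈P₀ = find (All.¬All⇒Any¬ (_∋? A) F (λ A∈F → ¬common (lose A∈P₀ A∈F)))

    strict : suc p ! * length F < binomProduct n k 1 (suc p)
    strict = nontrivial-strict p 3≤k kℓ≤n F dF iF (here refl) noCommon
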